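{- Let $q$ be a prime power, let $m,n\ge 1$, and let $\mathcal{C}$ be an $\mathbb{F}_{q^m}$-linear subspace of $\mathbb{F}_{q^m}^n$. If $\mathcal{C}$ is rank-metric intersecting, then $\mathcal{C}$ is Hamming-metric intersecting.
   Context: Support: fix an $\mathbb{F}_q$-basis $\Gamma$ of $\mathbb{F}_{q^m}$. For $x=(x_1,\dots,x_n)\in\mathbb{F}_{q^m}^n$ let $\mathrm{Mat}_\Gamma(x)\in\mathbb{F}_q^{m\times n}$ be the matrix whose $j$-th column is the coordinate vector of $x_j$ in the basis $\Gamma$. The (rank) support $\sigma(x)\subseteq\mathbb{F}_q^n$ is the $\mathbb{F}_q$-row space of $\mathrm{Mat}_\Gamma(x)$; it is independent of $\Gamma$. The code $\mathcal{C}$ is rank-metric intersecting if $\sigma(c)\cap\sigma(c')\ne\{0\}$ for all $c,c'\in\mathcal{C}\setminus\{0\}$. It is Hamming-metric intersecting if for any two nonzero codewords $c,c'\in\mathcal{C}$ there is a coordinate $i$ with $c_i\neq 0$ and $c'_i\neq 0$. -}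

module Defs where

open import Level using (suc; _⊔_)
open import Algebra.Bundles using (CommutativeRing)
open import Algebra.Morphism.Structures using (module RingMorphisms)
open import Data.Fin using (Fin)
open import Data.Nat using (ℕ; _^_; _≥_)
open import Data.Nat.Primality using (Prime)
open import Data.Product using (∃; ∃₂; _×_; proj₁)
open import Data.Vec.Functional using (Vector; map; zipWith; replicate)
import Data.Vec.Functional.Relation.Binary.Equality.Setoid as VectorEquality
open import Function.Bundles using (Inverse)
open import Relation.Binary.Definitions using (_Respects_)
open import Relation.Binary.PropositionalEquality as ≡ using (_≡_)
open import Relation.Nullary using (¬_)
open import Relation.Unary using (Pred; _∈_; _∩_; _≐_)
import Algebra.Properties.Monoid.Sum as Sum

IsPrimePower : ℕ → Set
IsPrimePower q = ∃₂ λ p k → Prime p × k ≥ 1 × q ≡ p ^ k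

-- The enumeration makes `_≈_` decidable, so `x ≉ 0#` is the right notion of
-- being nonzero and the primitive apartness of `HeytingField` is not needed.
record FiniteField a ℓ (q : ℕ) : Set (suc (a ⊔ ℓ)) where
  field
    commutativeRing : CommutativeRing a ℓ

  open CommutativeRing commutativeRing public

  field
    1≉0         : 1# ≉ 0#
    inverse     : ∀ x → x ≉ 0# → ∃ λ y → x * y ≈ 1#
    enumeration : Inverse setoid (≡.setoid (Fin q))

  open Sum +-monoid public using (sum)
  open VectorEquality setoid public using (_≋_)

  0ᵛ : ∀ {n} → Vector Carrier n
  0ᵛ = replicate _ 0#

module _ {a ℓ q} (F : FiniteField a ℓ q) where
  open FiniteField F

  -- The ambient space consists of functions `Fin n → Carrier` up to `_≋_`, so
  -- a subset has to respect `_≋_`.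
  record IsSubspace {n p} (C : Pred (Vector Carrier n) p) : Set (a ⊔ ℓ ⊔ p) where
    field
      resp     : C Respects _≋_
      0-closed : 0ᵛ ∈ C
      +-closed : ∀ {x y} → x ∈ C → y ∈ C → zipWith _+_ x y ∈ C
      *-closed : ∀ s {x} → x ∈ C → map (s *_) x ∈ C

  RowSpace : ∀ {m n} → (Fin m → Fin n → Carrier) → Pred (Vector Carrier n) (a ⊔ ℓ)
  RowSpace {m} M v = ∃ λ (s : Vector Carrier m) → ∀ j → v j ≈ sum (λ i → s i * M i j)

  HammingIntersecting : ∀ {n p} → Pred (Vector Carrier n) p → Set (a ⊔ ℓ ⊔ p)
  HammingIntersecting C = ∀ {c c′} → c ∈ C → c′ ∈ C → ¬ c ≋ 0ᵛ → ¬ c′ ≋ 0ᵛ →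
    ∃ λ i → c i ≉ 0# × c′ i ≉ 0#

record Extension {a ℓ b ℓ′ q r} (K : FiniteField a ℓ q) (L : FiniteField b ℓ′ r)
                 : Set (a ⊔ ℓ ⊔ b ⊔ ℓ′) where
  private
    module K = FiniteField K
    module L = FiniteField L
  open RingMorphisms K.rawRing L.rawRing
  field
    ι                  : K.Carrier → L.Carrier
    isRingMonomorphism : IsRingMonomorphism ι

module _ {a ℓ b ℓ′ q r} {K : FiniteField a ℓ q} {L : FiniteField b ℓ′ r}
         (E : Extension K L) where
  private
    module K = FiniteField K
    module L = FiniteField L
  open Extension E

  record Basis (m : ℕ) : Set (a ⊔ ℓ ⊔ b ⊔ ℓ′) where
    field
      γ : Vector L.Carrier m

    combination : Vector K.Carrier m → L.Carrier
    combination s = L.sum (λ i → ι (s i) L.* γ i)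

    field
      independent : ∀ s → combination s L.≈ L.0# → s K.≋ K.0ᵛ
      spanning    : ∀ x → ∃ λ s → combination s L.≈ x

    coordinates : L.Carrier → Vector K.Carrier m
    coordinates x = proj₁ (spanning x)

  module _ {m} (Γ : Basis m) where
    open Basis Γ

    Mat : ∀ {n} → Vector L.Carrier n → Fin m → Fin n → K.Carrier
    Mat x i j = coordinates (x j) i

    σ : ∀ {n} → Vector L.Carrier n → Pred (Vector K.Carrier n) (a ⊔ ℓ)
    σ x = RowSpace K (Mat x)

    RankIntersecting : ∀ {n p} → Pred (Vector L.Carrier n) p → Set (a ⊔ ℓ ⊔ b ⊔ ℓ′ ⊔ p)
    RankIntersecting C = ∀ {c c′} → c ∈ C → c′ ∈ C → ¬ c L.≋ L.0ᵛ → ¬ c′ L.≋ L.0ᵛ →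
      ¬ (σ c ∩ σ c′ ≐ (K._≋ K.0ᵛ))

{-# OPTIONS --safe #-}
-- The j-th column of Mat_Γ(c) vanishes when c_j = 0, so every vector of σ(c)
-- is supported on the Hamming support of c.  Codewords with disjoint Hamming
-- supports therefore have rank supports meeting only in 0.
module Submission where

open import Defs
open import Data.Empty using (⊥-elim)
open import Data.Fin using (Fin)
import Data.Fin.Properties as Fin
open import Data.Nat using (ℕ; _^_; _≥_)
open import Data.Product using (_,_)
open import Data.Vec.Functional using (Vector)
open import Function.Properties.Inverse using (Inverse⇒Injection)
open import Relation.Binary.Definitions using (Decidable)
open import Relation.Nullary using (yes; no; contradiction; ¬?; _×-dec_)
open import Relation.Nullary.Decidable using (via-injection)
open import Relation.Unary using (Pred; _∈_; _∩_)
import Algebra.Properties.Monoid.Sum as Sum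

module _ {a ℓ q} (F : FiniteField a ℓ q) where
  open FiniteField F
  open Sum +-monoid using (sum-cong-≋; sum-replicate-zero)

  -- Injectivity of `enumeration` transfers decidable equality from `Fin q`, so coordinates can be
  -- tested for being zero.
  ≈-dec : Decidable _≈_
  ≈-dec = via-injection (Inverse⇒Injection enumeration) Fin._≟_

  sum-zero : ∀ {m} {t : Vector Carrier m} → t ≋ 0ᵛ → sum t ≈ 0#
  sum-zero {m} t≋0 = trans (sum-cong-≋ t≋0) (sum-replicate-zero m)

  module _ {m n} (M : Fin m → Fin n → Carrier) where

    -- Zero coefficients serve as witness. Any `v` pointwise equal to zero is allowed, matching the
    -- form of the zero space in `RankIntersecting`.
    0ᵛ∈RowSpace : ∀ {v} → v ≋ 0ᵛ → v ∈ RowSpace F M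
    0ᵛ∈RowSpace v≋0 = 0ᵛ , λ j → trans (v≋0 j) (sym (sum-zero λ i → zeroˡ (M i j)))

    RowSpace-zeroColumn : ∀ {v j} → v ∈ RowSpace F M → (∀ i → M i j ≈ 0#) → v j ≈ 0#
    RowSpace-zeroColumn {j = j} (s , v≈) col≈0 =
      trans (v≈ j) (sum-zero λ i → trans (*-congˡ (col≈0 i)) (zeroʳ (s i)))

module _ {a ℓ b ℓ′ q r} {K : FiniteField a ℓ q} {L : FiniteField b ℓ′ r}
         {E : Extension K L} {m} (Γ : Basis E m) where
  private
    module K = FiniteField K
    module L = FiniteField L
  open Basis Γ

  -- `coordinates` is merely a chosen witness of `spanning`; independence of the basis forces the
  -- choice at zero to be the zero vector.
  coordinates-zero : ∀ {x} → x L.≈ L.0# → coordinates x K.≋ K.0ᵛ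
  coordinates-zero {x} x≈0 with s , s≈x ← spanning x = independent s (L.trans s≈x x≈0)

  σ-zero : ∀ {n} {c : Vector L.Carrier n} {v j} →
           v ∈ σ E Γ c → c j L.≈ L.0# → v j K.≈ K.0#
  σ-zero {c = c} v∈σ cj≈0 = RowSpace-zeroColumn K (Mat E Γ c) v∈σ (coordinates-zero cj≈0)

proposition2p3 : ∀ {a ℓ b ℓ′ p} (q m n : ℕ) → IsPrimePower q → m ≥ 1 → n ≥ 1 →
    (K : FiniteField a ℓ q) (L : FiniteField b ℓ′ (q ^ m)) (E : Extension K L)
    (Γ : Basis E m) (C : Pred (Vector (FiniteField.Carrier L) n) p) →
    IsSubspace L C → RankIntersecting E Γ C → HammingIntersecting L C
proposition2p3 q m n _ _ _ K L E Γ C _ rank {c} {c′} c∈C c′∈C c≉0 c′≉0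
  -- `RankIntersecting` is a negation and hands over no coordinate; a decidable search over the
  -- finitely many indices supplies one, and the hypothesis rules out a failed search.
  with Fin.any? (λ i → ¬? (≈-dec L (c i) 0#) ×-dec ¬? (≈-dec L (c′ i) 0#))
  where open FiniteField L using (0#)
... | yes common = common
... | no disjoint = ⊥-elim (rank c∈C c′∈C c≉0 c′≉0 (meet⊆0 , 0⊆meet))
  where
  module K = FiniteField K
  open FiniteField L using (0#)

  meet⊆0 : ∀ {v} → v ∈ σ E Γ c ∩ σ E Γ c′ → v K.≋ K.0ᵛ
  -- By `disjoint`, one of the two codewords vanishes at `j`; membership in the support of that
  -- codeword then forces `v j` to be zero.
  meet⊆0 (v∈σc , v∈σc′) j with ≈-dec L (c j) 0# | ≈-dec L (c′ j) 0#
  ... | yes cj≈0 | _         = σ-zero Γ v∈σc cj≈0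
  ... | no _     | yes c′j≈0 = σ-zero Γ v∈σc′ c′j≈0
  ... | no cj≉0  | no c′j≉0  = contradiction (j , cj≉0 , c′j≉0) disjoint

  0⊆meet : ∀ {v} → v K.≋ K.0ᵛ → v ∈ σ E Γ c ∩ σ E Γ c′
  0⊆meet v≋0 = 0ᵛ∈RowSpace K (Mat E Γ c) v≋0 , 0ᵛ∈RowSpace K (Mat E Γ c′) v≋0
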